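{- Let $A\in\mathbb{R}^{m\times n}$ have full rank $m\le n$, let $D\in\mathbb{R}^{n\times n}$ be a diagonal matrix with positive diagonal entries, let $p\in\mathbb{R}^m$, let $\zeta\in[0,1]$, and let $Q\in\mathbb{R}^{m\times m}$ be a symmetric positive definite matrix such that $$\frac{2}{2+\zeta}\le\sigma_{\min}^2(Q^{ -1/2}AD)\le\sigma_{\max}^2(Q^{ -1/2}AD)\le\frac{2}{2-\zeta}.$$ Let $\tilde z^t$ be the approximate solution returned after $t$ iterations of the Conjugate Gradient method, started at $\tilde z^0=0$, applied to $Q^{ -1/2}AD^2A^{\top}Q^{ -1/2}z=Q^{ -1/2}p$. Then the residual norms $\|Q^{ -1/2}AD^2A^{\top}Q^{ -1/2}\tilde z^j-Q^{ -1/2}p\|_2$ are monotonically non-increasing in $j$, and for every $t\ge0$ $$\|Q^{ -1/2}AD^2A^{\top}Q^{ -1/2}\tilde z^t-Q^{ -1/2}p\|_2\le\zeta^t\,\|Q^{ -1/2}p\|_2 .$$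
   Context: $\sigma_{\min}(\cdot)$ and $\sigma_{\max}(\cdot)$ denote the smallest and largest singular values (here, of an $m\times n$ matrix, the $m$-th and the first). Convention: $\zeta^0=1$. Once the exact solution has been reached, subsequent CG iterates are taken equal to it. -}

module Defs where

open import Algebra.Bundles using (CommutativeRing; Semiring)
import Algebra.Definitions.RawSemiring as RawSemiringDefinitions
import Algebra.Properties.Ring as RingProperties
open import Data.Bool.Base using (if_then_else_)
open import Data.Fin.Base as Fin using (Fin; inject≤; fromℕ)
import Data.Fin.Properties as Fin
open import Data.Nat.Base as ℕ using (ℕ; NonZero)
open import Data.Product.Base using (_×_; _,_; ∃)
open import Data.Sum.Base using (inj₁; inj₂)
open import Data.Vec.Functional using (Vector; transpose; zipWith; map; replicate)
import Data.Vec.Functional.Relation.Binary.Equality.Setoid as VectorEquality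
open import Level using (0ℓ)
open import Relation.Binary.Core using (Rel)
import Relation.Binary.Construct.NonStrictToStrict as ToStrict
open import Relation.Binary.PropositionalEquality.Core using (_≡_)
open import Relation.Binary.Structures using (IsDecTotalOrder)
open import Relation.Nullary.Decidable using (does)
open import Relation.Nullary.Negation using (¬_)
open import Relation.Unary using (Pred; _∈_)

-- The classical real numbers: a Dedekind-complete (hence Archimedean) ordered
-- field.  These axioms characterise ℝ up to unique isomorphism, so results are
-- stated for an arbitrary inhabitant.  The decidable order and the existence
-- of suprema of arbitrary predicates are those of classical analysis.

record RealField : Set₁ where
  infix  4 _≤_
  infix  8 _⁻¹
  infixl 7 _/_

  field
    commutativeRing : CommutativeRing 0ℓ 0ℓ

  open CommutativeRing commutativeRing public

  field
    -- 0# ⁻¹ is left unspecified.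
    _⁻¹         : Carrier → Carrier
    ⁻¹-cong     : ∀ {x y} → x ≈ y → x ⁻¹ ≈ y ⁻¹
    ⁻¹-inverseʳ : ∀ {x} → ¬ x ≈ 0# → x * x ⁻¹ ≈ 1#
    1≉0         : ¬ 1# ≈ 0#

    _≤_             : Rel Carrier 0ℓ
    isDecTotalOrder : IsDecTotalOrder _≈_ _≤_
    +-monoˡ-≤       : ∀ z {x y} → x ≤ y → x + z ≤ y + z
    *-nonNeg        : ∀ {x y} → 0# ≤ x → 0# ≤ y → 0# ≤ x * y

  UpperBound : Pred Carrier 0ℓ → Carrier → Set
  UpperBound P u = ∀ x → x ∈ P → x ≤ u

  field
    sup       : (P : Pred Carrier 0ℓ) → ∃ P → ∃ (UpperBound P) → Carrier
    sup-upper : ∀ P ne bd → UpperBound P (sup P ne bd)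
    sup-least : ∀ P ne bd u → UpperBound P u → sup P ne bd ≤ u

  open IsDecTotalOrder isDecTotalOrder public
    using (_≟_; _≤?_; total; antisym; ≤-respˡ-≈; ≤-respʳ-≈)
    renaming (reflexive to ≤-reflexive; refl to ≤-refl; trans to ≤-trans)
  open ToStrict _≈_ _≤_ public using (_<_)
  open RawSemiringDefinitions (Semiring.rawSemiring semiring) public using (_^_; sum)
  open RingProperties ring using (-‿distribˡ-*; -‿distribʳ-*; -‿involutive)

  _/_ : Carrier → Carrier → Carrier
  x / y = x * y ⁻¹

  2# : Carrier
  2# = 1# + 1#

  +-nonNeg : ∀ {x y} → 0# ≤ x → 0# ≤ y → 0# ≤ x + y
  +-nonNeg {x} {y} 0≤x 0≤y =
    ≤-trans 0≤y (≤-respˡ-≈ (+-identityˡ y) (+-monoˡ-≤ y 0≤x))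

  square-nonNeg : ∀ x → 0# ≤ x * x
  square-nonNeg x with total 0# x
  ... | inj₁ 0≤x = *-nonNeg 0≤x 0≤x
  ... | inj₂ x≤0 = ≤-respʳ-≈ -x*-x≈x*x (*-nonNeg 0≤-x 0≤-x)
    where
    0≤-x : 0# ≤ - x
    0≤-x = ≤-respˡ-≈ (-‿inverseʳ x)
             (≤-respʳ-≈ (+-identityˡ (- x)) (+-monoˡ-≤ (- x) x≤0))

    -x*-x≈x*x : (- x) * (- x) ≈ x * x
    -x*-x≈x*x = trans (sym (-‿distribˡ-* x (- x)))
                  (trans (-‿cong (sym (-‿distribʳ-* x x))) (-‿involutive (x * x)))

  0≤1 : 0# ≤ 1#
  0≤1 = ≤-respʳ-≈ (*-identityˡ 1#) (square-nonNeg 1#)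

  square≤⇒≤ : ∀ {a} → 0# ≤ a → ∀ x → x * x ≤ a → x ≤ 1# + a
  square≤⇒≤ {a} 0≤a x x²≤a with total x 1#
  ... | inj₁ x≤1 = ≤-trans x≤1
                     (≤-respˡ-≈ (+-identityˡ 1#)
                       (≤-respʳ-≈ (+-comm a 1#) (+-monoˡ-≤ 1# 0≤a)))
  ... | inj₂ 1≤x = ≤-trans x≤x²
                     (≤-trans x²≤a (≤-respˡ-≈ (+-identityˡ a) (+-monoˡ-≤ a 0≤1)))
    where
    0≤x-1 : 0# ≤ x - 1#
    0≤x-1 = ≤-respˡ-≈ (-‿inverseʳ 1#) (+-monoˡ-≤ (- 1#) 1≤x)

    [x-1]x+x≈x² : (x - 1#) * x + x ≈ x * x
    [x-1]x+x≈x² =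
      trans (+-congˡ (sym (*-identityˡ x)))
        (trans (sym (distribʳ x (x - 1#) 1#))
          (*-congʳ (trans (+-assoc x (- 1#) 1#)
            (trans (+-congˡ (-‿inverseˡ 1#)) (+-identityʳ x)))))

    x≤x² : x ≤ x * x
    x≤x² = ≤-respˡ-≈ (+-identityˡ x)
             (≤-respʳ-≈ [x-1]x+x≈x²
               (+-monoˡ-≤ x (*-nonNeg 0≤x-1 (≤-trans 0≤1 1≤x))))

  √ : ∀ a → 0# ≤ a → Carrier
  √ a 0≤a = sup (λ x → x * x ≤ a)
                (0# , ≤-respˡ-≈ (sym (zeroˡ 0#)) 0≤a)
                (1# + a , square≤⇒≤ 0≤a)

module LinearAlgebra (ℝ : RealField) where

  open RealField ℝ
  open VectorEquality setoid public using (_≋_)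

  infixl 6 _+ᵥ_ _-ᵥ_
  infixl 7 _*ₘ_
  infixr 7 _*ᵥ_ _·ᵥ_
  infix  8 _∙_
  infix  4 _≋ₘ_

  ℝ^ : ℕ → Set
  ℝ^ = Vector Carrier

  Matrix : ℕ → ℕ → Set
  Matrix m n = Vector (ℝ^ n) m

  private variable
    k l m n : ℕ

  0ᵥ : ℝ^ n
  0ᵥ = replicate _ 0#

  _+ᵥ_ _-ᵥ_ : ℝ^ n → ℝ^ n → ℝ^ n
  _+ᵥ_ = zipWith _+_
  _-ᵥ_ = zipWith _-_

  _·ᵥ_ : Carrier → ℝ^ n → ℝ^ n
  c ·ᵥ x = map (c *_) x

  _∙_ : ℝ^ n → ℝ^ n → Carrier
  x ∙ y = sum (zipWith _*_ x y)

  ∙-nonNeg : (x : ℝ^ n) → 0# ≤ x ∙ x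
  ∙-nonNeg {ℕ.zero}  x = ≤-refl
  ∙-nonNeg {ℕ.suc n} x =
    +-nonNeg (square-nonNeg (x Fin.zero)) (∙-nonNeg (λ i → x (Fin.suc i)))

  ∥_∥ : ℝ^ n → Carrier
  ∥ x ∥ = √ (x ∙ x) (∙-nonNeg x)

  _*ᵥ_ : Matrix m n → ℝ^ n → ℝ^ m
  (A *ᵥ x) i = A i ∙ x

  _*ₘ_ : Matrix k l → Matrix l m → Matrix k m
  (A *ₘ B) i j = A i ∙ transpose B j

  _≋ₘ_ : Matrix m n → Matrix m n → Set
  A ≋ₘ B = ∀ i → A i ≋ B i

  I : Matrix n n
  I i j = if does (i Fin.≟ j) then 1# else 0#

  IsDiagonal : Matrix n n → Set
  IsDiagonal D = ∀ i j → ¬ i ≡ j → D i j ≈ 0#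

  IsSymmetric : Matrix n n → Set
  IsSymmetric Q = transpose Q ≋ₘ Q

  IsSymPosDef : Matrix n n → Set
  IsSymPosDef Q = IsSymmetric Q × (∀ x → ¬ x ≋ 0ᵥ → 0# < x ∙ (Q *ᵥ x))

  IsOrthogonal : Matrix n n → Set
  IsOrthogonal U = transpose U *ₘ U ≋ₘ I × U *ₘ transpose U ≋ₘ I

  IsInverse : Matrix n n → Matrix n n → Set
  IsInverse Q P = Q *ₘ P ≋ₘ I × P *ₘ Q ≋ₘ I

  -- S = Q^{-1/2}, the unique symmetric positive definite square root of Q⁻¹.
  IsInverseSqrt : Matrix n n → Matrix n n → Set
  IsInverseSqrt Q S = IsSymPosDef S × IsInverse Q (S *ₘ S)

  -- r is the dimension of the column space of A: the columns of B are a basis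
  -- of the range of A.
  HasRank : Matrix m n → ℕ → Set
  HasRank {m} {n} A r = ∃ λ (B : Matrix m r) →
      (∀ y → B *ᵥ y ≋ 0ᵥ → y ≋ 0ᵥ)
    × (∀ x → ∃ λ y → A *ᵥ x ≋ B *ᵥ y)
    × (∀ y → ∃ λ x → B *ᵥ y ≋ A *ᵥ x)

  rectDiagonal : m ℕ.≤ n → ℝ^ m → Matrix m n
  rectDiagonal m≤n σ i j = if does (inject≤ i m≤n Fin.≟ j) then σ i else 0#

  -- σ is the (uniquely determined) non-increasing list of the m singular
  -- values of M, as given by a singular value decomposition M = U Σ Vᵀ.
  IsSingularValues : m ℕ.≤ n → Matrix m n → ℝ^ m → Set
  IsSingularValues {m} {n} m≤n M σ =
      (∀ i → 0# ≤ σ i)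
    × (∀ i j → i Fin.≤ j → σ j ≤ σ i)
    × (∃ λ (U : Matrix m m) → ∃ λ (V : Matrix n n) →
         IsOrthogonal U × IsOrthogonal V
       × M ≋ₘ U *ₘ rectDiagonal m≤n σ *ₘ transpose V)

  σ-max σ-min : .{{_ : NonZero m}} → ℝ^ m → Carrier
  σ-max {ℕ.suc m} σ = σ Fin.zero
  σ-min {ℕ.suc m} σ = σ (fromℕ m)

  -- The Hestenes–Stiefel iteration for M z = b.  The state holds the iterate,
  -- the recursively updated residual b - M z, and the search direction.
  record CGState (m : ℕ) : Set where
    field
      iterate residual direction : ℝ^ m

  cgInit : ℝ^ m → CGState m
  cgInit b = record { iterate = 0ᵥ ; residual = b ; direction = b }

  -- Once the residual vanishes, the state no longer changes.
  cgStep : Matrix m m → CGState m → CGState m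
  cgStep M s = if does (Fin.all? (λ i → r i ≟ 0#)) then s else next
    where
    open CGState s renaming (iterate to z; residual to r; direction to d)
    α  = (r ∙ r) / (d ∙ (M *ᵥ d))
    r′ = r -ᵥ α ·ᵥ (M *ᵥ d)
    β  = (r′ ∙ r′) / (r ∙ r)
    next = record
      { iterate = z +ᵥ α ·ᵥ d ; residual = r′ ; direction = r′ +ᵥ β ·ᵥ d }

  cgState : Matrix m m → ℝ^ m → ℕ → CGState m
  cgState M b ℕ.zero    = cgInit b
  cgState M b (ℕ.suc t) = cgStep M (cgState M b t)

  cg : Matrix m m → ℝ^ m → ℕ → ℝ^ m
  cg M b t = CGState.iterate (cgState M b t)

{-# OPTIONS --safe #-}

-- With K = Q^{-1/2} A D the system matrix is M = K Kᵀ, whose eigenvalues are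
-- the squared singular values of K, so that |w - M w| ≤ (ζ/2) |M w| for all w.
-- Consecutive CG residuals r, r′ satisfy r - r′ = M w with w = α d, where r′ is
-- orthogonal both to r and to the search direction d.  Hence
-- |r′|² = ⟨r′, w - M w⟩ gives |r′| ≤ (ζ/2) |r - r′|, and by Pythagoras
-- |r′|² ≤ (ζ²/4) (|r|² + |r′|²); since ζ ≤ 1 this yields |r′| ≤ ζ |r|.

module Submission where

open import Defs
open import Algebra.Bundles using (CommutativeRing; RawRing)
import Algebra.Properties.Semiring.Mult.TCOptimised as Multiples
import Algebra.Properties.Ring as RingProperties
import Algebra.Properties.AbelianGroup as AbelianGroupProperties
import Algebra.Properties.CommutativeSemigroup as CommutativeSemigroupProperties
import Algebra.Properties.Semiring.Sum as Sum
import Algebra.Solver.Ring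
open import Algebra.Solver.Ring.AlmostCommutativeRing
  using (_-Raw-AlmostCommutative⟶_; fromCommutativeRing)
open import Data.Bool.Base using (if_then_else_)
open import Data.Empty using (⊥-elim)
open import Data.Fin.Base as Fin using (Fin; inject≤; fromℕ)
import Data.Fin.Properties as Fin
open import Data.Maybe.Base using (Maybe; just; nothing)
open import Data.Nat.Base as ℕ using (ℕ; NonZero)
import Data.Nat.Properties as ℕ
open import Data.Product.Base using (_×_; _,_; proj₁; proj₂)
open import Data.Sum.Base using (inj₁; inj₂)
open import Data.Vec.Functional using (transpose; zipWith)
import Data.Vec.Functional.Relation.Binary.Equality.Setoid as VectorEquality
open import Function.Base using (_∘_)
open import Level using (0ℓ)
import Relation.Binary.PropositionalEquality.Core as ≡
open ≡ using (_≡_)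
import Relation.Binary.Reasoning.Setoid as SetoidReasoning
open import Relation.Nullary.Decidable using (Dec; does; yes; no)
open import Relation.Nullary.Negation using (¬_)

-- `cgStep` branches on `does` of a decision. With an explicit motive, a property of its result
-- follows from the evidence for each branch, without abstracting over the unfolded goal.
if-elim : {X A : Set} (P : X → Set) (A? : Dec A) {x y : X} →
          (A → P x) → (¬ A → P y) → P (if does A? then x else y)
if-elim P (yes a) px py = px a
if-elim P (no ¬a) px py = py ¬a

-- A commutative-ring solver with integer coefficients, encoded as reduced
-- differences (a , b) = a - b of naturals: unlike coefficients in the ring
-- itself, these can be compared, so that opposite terms cancel.
module DifferenceSolver (R : CommutativeRing 0ℓ 0ℓ) where

  open CommutativeRing R hiding (zero)
  open Multiples semiring renaming (_×_ to _·_)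
  open RingProperties ring
  open AbelianGroupProperties +-abelianGroup using (⁻¹-∙-comm)
  open CommutativeSemigroupProperties +-commutativeSemigroup using (interchange)
  open SetoidReasoning setoid

  reduce : ℕ → ℕ → ℕ × ℕ
  reduce a         ℕ.zero    = a , 0
  reduce ℕ.zero    (ℕ.suc b) = 0 , ℕ.suc b
  reduce (ℕ.suc a) (ℕ.suc b) = reduce a b

  coefficients : RawRing 0ℓ 0ℓ
  coefficients = record
    { Carrier = ℕ × ℕ
    ; _≈_     = _≡_
    ; _+_     = λ { (a , b) (c , d) → reduce (a ℕ.+ c) (b ℕ.+ d) }
    ; _*_     = λ { (a , b) (c , d) → reduce (a ℕ.* c ℕ.+ b ℕ.* d) (a ℕ.* d ℕ.+ b ℕ.* c) }
    ; -_      = λ { (a , b) → b , a }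
    ; 0#      = 0 , 0
    ; 1#      = 1 , 0
    }

  -- The separate case of a zero second component makes `0 , 0` and `1 , 0` denote `0#` and `1#`
  -- definitionally, so that solved equations match goals written with these constants.
  ⟦_⟧ : ℕ × ℕ → Carrier
  ⟦ a , ℕ.zero ⟧  = a · 1#
  ⟦ a , ℕ.suc b ⟧ = a · 1# - ℕ.suc b · 1#

  ⟦⟧-difference : ∀ a b → ⟦ a , b ⟧ ≈ a · 1# - b · 1#
  ⟦⟧-difference a ℕ.zero    = sym (trans (+-congˡ -0#≈0#) (+-identityʳ _))
  ⟦⟧-difference a (ℕ.suc b) = refl

  +-difference : ∀ a b c d → (a + c) - (b + d) ≈ (a - b) + (c - d)
  +-difference a b c d = trans (+-congˡ (sym (⁻¹-∙-comm b d))) (interchange a c (- b) (- d))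

  *-difference : ∀ a b c d →
                 (a * c + b * d) - (a * d + b * c) ≈ (a - b) * (c - d)
  *-difference a b c d = begin
    (a * c + b * d) - (a * d + b * c)  ≈⟨ +-congˡ (-‿cong (+-comm _ _)) ⟩
    (a * c + b * d) - (b * c + a * d)  ≈⟨ +-difference _ _ _ _ ⟩
    (a * c - b * c) + (b * d - a * d)  ≈⟨ +-cong ([y-z]x≈yx-zx c a b) (neg-difference (a * d) (b * d)) ⟨
    (a - b) * c + - (a * d - b * d)    ≈⟨ +-congˡ (-‿cong ([y-z]x≈yx-zx d a b)) ⟨
    (a - b) * c + - ((a - b) * d)      ≈⟨ x[y-z]≈xy-xz (a - b) c d ⟨
    (a - b) * (c - d)                  ∎
    where
    neg-difference : ∀ x y → - (x - y) ≈ y - x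
    neg-difference x y = trans (sym (⁻¹-∙-comm x (- y)))
      (trans (+-congˡ (-‿involutive y)) (+-comm _ _))

  ⟦reduce⟧ : ∀ a b → ⟦ reduce a b ⟧ ≈ a · 1# - b · 1#
  ⟦reduce⟧ a         ℕ.zero    = ⟦⟧-difference a 0
  ⟦reduce⟧ ℕ.zero    (ℕ.suc b) = refl
  ⟦reduce⟧ (ℕ.suc a) (ℕ.suc b) = begin
    ⟦ reduce a b ⟧                       ≈⟨ ⟦reduce⟧ a b ⟩
    a · 1# - b · 1#                      ≈⟨ +-identityˡ _ ⟨
    0# + (a · 1# - b · 1#)               ≈⟨ +-congʳ (-‿inverseʳ 1#) ⟨
    (1# - 1#) + (a · 1# - b · 1#)        ≈⟨ +-difference _ _ _ _ ⟨
    (1# + a · 1#) - (1# + b · 1#)        ≈⟨ +-cong (×-homo-+ 1# 1 a) (-‿cong (×-homo-+ 1# 1 b)) ⟨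
    ℕ.suc a · 1# - ℕ.suc b · 1#          ∎

  homomorphism : coefficients -Raw-AlmostCommutative⟶ fromCommutativeRing R
  homomorphism = record
    { ⟦_⟧    = ⟦_⟧
    ; +-homo = λ { (a , b) (c , d) → begin
        ⟦ reduce (a ℕ.+ c) (b ℕ.+ d) ⟧               ≈⟨ ⟦reduce⟧ (a ℕ.+ c) (b ℕ.+ d) ⟩
        (a ℕ.+ c) · 1# - (b ℕ.+ d) · 1#              ≈⟨ +-cong (×-homo-+ 1# a c) (-‿cong (×-homo-+ 1# b d)) ⟩
        (a · 1# + c · 1#) - (b · 1# + d · 1#)        ≈⟨ +-difference _ _ _ _ ⟩
        (a · 1# - b · 1#) + (c · 1# - d · 1#)        ≈⟨ +-cong (⟦⟧-difference a b) (⟦⟧-difference c d) ⟨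
        ⟦ a , b ⟧ + ⟦ c , d ⟧                        ∎ }
    ; *-homo = λ { (a , b) (c , d) → begin
        ⟦ reduce (a ℕ.* c ℕ.+ b ℕ.* d) (a ℕ.* d ℕ.+ b ℕ.* c) ⟧
          ≈⟨ ⟦reduce⟧ (a ℕ.* c ℕ.+ b ℕ.* d) (a ℕ.* d ℕ.+ b ℕ.* c) ⟩
        (a ℕ.* c ℕ.+ b ℕ.* d) · 1# - (a ℕ.* d ℕ.+ b ℕ.* c) · 1#
          ≈⟨ +-cong (×1-homo-+* a c b d) (-‿cong (×1-homo-+* a d b c)) ⟩
        (a · 1# * (c · 1#) + b · 1# * (d · 1#)) - (a · 1# * (d · 1#) + b · 1# * (c · 1#))
          ≈⟨ *-difference _ _ _ _ ⟩
        (a · 1# - b · 1#) * (c · 1# - d · 1#)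
          ≈⟨ *-cong (⟦⟧-difference a b) (⟦⟧-difference c d) ⟨
        ⟦ a , b ⟧ * ⟦ c , d ⟧ ∎ }
    ; -‿homo = λ { (a , b) → begin
        ⟦ b , a ⟧              ≈⟨ ⟦⟧-difference b a ⟩
        b · 1# - a · 1#        ≈⟨ +-congʳ (-‿involutive _) ⟨
        - - (b · 1#) - a · 1#  ≈⟨ ⁻¹-∙-comm _ _ ⟩
        - (- (b · 1#) + a · 1#)  ≈⟨ -‿cong (+-comm _ _) ⟩
        - (a · 1# - b · 1#)    ≈⟨ -‿cong (⟦⟧-difference a b) ⟨
        - ⟦ a , b ⟧            ∎ }
    ; 0-homo = refl
    ; 1-homo = refl
    }
    where
    ×1-homo-+* : ∀ a b c d → (a ℕ.* b ℕ.+ c ℕ.* d) · 1# ≈ a · 1# * (b · 1#) + c · 1# * (d · 1#)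
    ×1-homo-+* a b c d =
      trans (×-homo-+ 1# (a ℕ.* b) (c ℕ.* d)) (+-cong (×1-homo-* a b) (×1-homo-* c d))

  _≟ᶜ_ : ∀ x y → Maybe (⟦ x ⟧ ≈ ⟦ y ⟧)
  (a , b) ≟ᶜ (c , d) with a ℕ.≟ c | b ℕ.≟ d
  ... | yes ≡.refl | yes ≡.refl = just refl
  ... | _          | _          = nothing

  open Algebra.Solver.Ring coefficients (fromCommutativeRing R) homomorphism _≟ᶜ_ public
    using (solve; _:=_; _:+_; _:*_; _:-_; :-_; con; Polynomial)

-- Ordered-field inequalities, division and square roots.

module OrderedField (ℝ : RealField) where

  open RealField ℝ
  open DifferenceSolver commutativeRing
  open SetoidReasoning setoid

  :1 :2 : ∀ {n} → Polynomial n
  :1 = con (1 , 0)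
  :2 = :1 :+ :1

  ≤⇒0≤- : ∀ {x y} → x ≤ y → 0# ≤ y - x
  ≤⇒0≤- {x} x≤y = ≤-respˡ-≈ (-‿inverseʳ x) (+-monoˡ-≤ (- x) x≤y)

  0≤-⇒≤ : ∀ {x y} → 0# ≤ y - x → x ≤ y
  0≤-⇒≤ {x} {y} h = ≤-respˡ-≈ (+-identityˡ x)
    (≤-respʳ-≈ (solve 2 (λ x y → y :- x :+ x := y) refl x y) (+-monoˡ-≤ x h))

  *-monoʳ-≤ : ∀ {x y z} → 0# ≤ z → x ≤ y → x * z ≤ y * z
  *-monoʳ-≤ {x} {y} {z} 0≤z x≤y = 0≤-⇒≤
    (≤-respʳ-≈ (solve 3 (λ x y z → (y :- x) :* z := y :* z :- x :* z) refl x y z)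
      (*-nonNeg (≤⇒0≤- x≤y) 0≤z))

  *-monoˡ-≤ : ∀ {x y z} → 0# ≤ z → x ≤ y → z * x ≤ z * y
  *-monoˡ-≤ {x} {y} {z} 0≤z x≤y =
    ≤-respˡ-≈ (*-comm x z) (≤-respʳ-≈ (*-comm y z) (*-monoʳ-≤ 0≤z x≤y))

  *-mono-≤ : ∀ {x y u v} → 0# ≤ u → 0# ≤ y → x ≤ y → u ≤ v → x * u ≤ y * v
  *-mono-≤ 0≤u 0≤y x≤y u≤v = ≤-trans (*-monoʳ-≤ 0≤u x≤y) (*-monoˡ-≤ 0≤y u≤v)

  1≰0 : ¬ 1# ≤ 0#
  1≰0 1≤0 = 1≉0 (antisym 1≤0 0≤1)

  1≤⇒0≤ : ∀ {x} → 1# ≤ x → 0# ≤ x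
  1≤⇒0≤ = ≤-trans 0≤1

  1≤⇒≉0 : ∀ {x} → 1# ≤ x → ¬ x ≈ 0#
  1≤⇒≉0 1≤x x≈0 = 1≰0 (≤-respʳ-≈ x≈0 1≤x)

  ⁻¹-inverseˡ : ∀ {x} → ¬ x ≈ 0# → x ⁻¹ * x ≈ 1#
  ⁻¹-inverseˡ x≉0 = trans (*-comm _ _) (⁻¹-inverseʳ x≉0)

  x/y*y≈x : ∀ x {y} → ¬ y ≈ 0# → x / y * y ≈ x
  x/y*y≈x x {y} y≉0 = begin
    x * y ⁻¹ * y    ≈⟨ *-assoc x (y ⁻¹) y ⟩
    x * (y ⁻¹ * y)  ≈⟨ *-congˡ (⁻¹-inverseˡ y≉0) ⟩
    x * 1#          ≈⟨ *-identityʳ x ⟩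
    x               ∎

  -- The hypothesis `1# ≤ y` supplies both `0# ≤ y` and `¬ y ≈ 0#`; the intended denominators
  -- `2# + ζ` and `2# - ζ` satisfy it because ζ lies in [0,1].
  /≤⇒≤* : ∀ {x y z} → 1# ≤ y → x / y ≤ z → x ≤ z * y
  /≤⇒≤* 1≤y h = ≤-respˡ-≈ (x/y*y≈x _ (1≤⇒≉0 1≤y)) (*-monoʳ-≤ (1≤⇒0≤ 1≤y) h)

  ≤/⇒*≤ : ∀ {x y z} → 1# ≤ y → z ≤ x / y → z * y ≤ x
  ≤/⇒*≤ 1≤y h = ≤-respʳ-≈ (x/y*y≈x _ (1≤⇒≉0 1≤y)) (*-monoʳ-≤ (1≤⇒0≤ 1≤y) h)

  square≈0⇒≈0 : ∀ {x} → x * x ≈ 0# → x ≈ 0#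
  square≈0⇒≈0 {x} x²≈0 with x ≟ 0#
  ... | yes x≈0 = x≈0
  ... | no  x≉0 = begin
    x               ≈⟨ x/y*y≈x x x≉0 ⟨
    x * x ⁻¹ * x    ≈⟨ solve 2 (λ x y → x :* y :* x := x :* x :* y) refl x (x ⁻¹) ⟩
    x * x * x ⁻¹    ≈⟨ *-congʳ x²≈0 ⟩
    0# * x ⁻¹       ≈⟨ zeroˡ _ ⟩
    0#              ∎

  +≈0⇒≈0ˡ : ∀ {x y} → 0# ≤ x → 0# ≤ y → x + y ≈ 0# → x ≈ 0#
  +≈0⇒≈0ˡ {x} {y} 0≤x 0≤y x+y≈0 = antisym
    (≤-respʳ-≈ x+y≈0 (0≤-⇒≤ (≤-respʳ-≈ (solve 2 (λ x y → y := x :+ y :- x) refl x y) 0≤y)))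
    0≤x

  √-least : ∀ {a c} 0≤a → (∀ x → x * x ≤ a → x ≤ c) → √ a 0≤a ≤ c
  √-least 0≤a = sup-least _ _ _ _

  √-upper : ∀ {a} 0≤a x → x * x ≤ a → x ≤ √ a 0≤a
  √-upper 0≤a = sup-upper _ _ _

  √-mono : ∀ {a b} 0≤a 0≤b → a ≤ b → √ a 0≤a ≤ √ b 0≤b
  √-mono 0≤a 0≤b a≤b = √-least 0≤a (λ x x²≤a → √-upper 0≤b x (≤-trans x²≤a a≤b))

  √-nonNeg : ∀ {a} 0≤a → 0# ≤ √ a 0≤a
  √-nonNeg 0≤a = √-upper 0≤a 0# (≤-respˡ-≈ (sym (zeroˡ 0#)) 0≤a)

  -- By the supremum property it suffices to bound each `x` with `x * x ≤ a`. If `c` is nonzero,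
  -- `x / c` has square at most `b`. The case `c ≈ 0#` is separate since `ζ ^ t` may vanish; there
  -- `x` is nonpositive or its square is at most zero.
  √-scale : ∀ {a b c} 0≤a 0≤b → 0# ≤ c → a ≤ c * c * b → √ a 0≤a ≤ c * √ b 0≤b
  √-scale {a} {b} {c} 0≤a 0≤b 0≤c a≤c²b = √-least 0≤a bound
    where
    bound : ∀ x → x * x ≤ a → x ≤ c * √ b 0≤b
    bound x x²≤a with total x 0# | c ≟ 0#
    ... | inj₁ x≤0 | _ = ≤-trans x≤0 (*-nonNeg 0≤c (√-nonNeg 0≤b))
    ... | inj₂ 0≤x | yes c≈0 = ≤-trans (≤-reflexive (square≈0⇒≈0 (antisym x²≤0 (square-nonNeg x))))
                                 (*-nonNeg 0≤c (√-nonNeg 0≤b))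
      where
      x²≤0 : x * x ≤ 0#
      x²≤0 = ≤-respʳ-≈ (trans (*-congʳ (trans (*-congʳ c≈0) (zeroˡ c))) (zeroˡ b))
               (≤-trans x²≤a a≤c²b)
    ... | inj₂ 0≤x | no c≉0 =
      ≤-respˡ-≈ (trans (*-comm c _) (x/y*y≈x x c≉0))
        (*-monoˡ-≤ 0≤c (√-upper 0≤b (x / c) [x/c]²≤b))
      where
      [x/c]²≤b : x / c * (x / c) ≤ b
      [x/c]²≤b = ≤-respˡ-≈
        (solve 2 (λ x d → x :* x :* (d :* d) := x :* d :* (x :* d)) refl x (c ⁻¹))
        (≤-respʳ-≈ c²b/c²≈b
          (*-monoʳ-≤ (square-nonNeg (c ⁻¹)) (≤-trans x²≤a a≤c²b)))
        where
        c²b/c²≈b : c * c * b * (c ⁻¹ * c ⁻¹) ≈ b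
        c²b/c²≈b = begin
          c * c * b * (c ⁻¹ * c ⁻¹)    ≈⟨ solve 3 (λ c d b → c :* c :* b :* (d :* d) := (c :* d) :* (c :* d) :* b) refl c (c ⁻¹) b ⟩
          c * c ⁻¹ * (c * c ⁻¹) * b    ≈⟨ *-congʳ (*-cong (⁻¹-inverseʳ c≉0) (⁻¹-inverseʳ c≉0)) ⟩
          1# * 1# * b                  ≈⟨ trans (*-congʳ (*-identityˡ 1#)) (*-identityˡ b) ⟩
          b                            ∎

-- Inner products, adjoints and orthogonal or diagonal matrices.

module Vectors (ℝ : RealField) where

  open RealField ℝ
  open LinearAlgebra ℝ
  open OrderedField ℝ
  open DifferenceSolver commutativeRing
  open VectorEquality setoid using (≋-sym; ≋-trans)
  open Sum semiring using (sum-cong-≋; sum-remove; sum-replicate-zero; ∑-comm; *-distribˡ-sum; *-distribʳ-sum)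
  open SetoidReasoning setoid

  private variable
    k l m n : ℕ

  ∙-cong : {x x′ y y′ : ℝ^ n} → x ≋ x′ → y ≋ y′ → x ∙ y ≈ x′ ∙ y′
  ∙-cong x≋x′ y≋y′ = sum-cong-≋ (λ i → *-cong (x≋x′ i) (y≋y′ i))

  ∙-congˡ : {x y y′ : ℝ^ n} → y ≋ y′ → x ∙ y ≈ x ∙ y′
  ∙-congˡ = ∙-cong (λ _ → refl)

  ∙-comm : (x y : ℝ^ n) → x ∙ y ≈ y ∙ x
  ∙-comm x y = sum-cong-≋ (λ i → *-comm (x i) (y i))

  -- Addition and scaling are treated together because every CG update is of this shape; the update
  -- of the residual reduces to it with `- c`.
  ∙-add· : (x y : ℝ^ n) (c : Carrier) (z : ℝ^ n) → x ∙ (y +ᵥ c ·ᵥ z) ≈ x ∙ y + c * (x ∙ z)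
  ∙-add· {ℕ.zero} x y c z = solve 1 (λ c → con (0 , 0) := con (0 , 0) :+ c :* con (0 , 0)) refl c
  ∙-add· {ℕ.suc n} x y c z = trans (+-congˡ (∙-add· (x ∘ Fin.suc) (y ∘ Fin.suc) c (z ∘ Fin.suc)))
    (solve 6 (λ x y c z p q → x :* (y :+ c :* z) :+ (p :+ c :* q) := (x :* y :+ p) :+ c :* (x :* z :+ q))
      refl _ _ _ _ _ _)

  -ᵥ·≋+ᵥ-· : (y : ℝ^ n) (c : Carrier) (z : ℝ^ n) → y -ᵥ c ·ᵥ z ≋ y +ᵥ (- c) ·ᵥ z
  -ᵥ·≋+ᵥ-· y c z i = solve 3 (λ y c z → y :- c :* z := y :+ (:- c) :* z) refl (y i) c (z i)

  ∙-sub· : (x y : ℝ^ n) (c : Carrier) (z : ℝ^ n) → x ∙ (y -ᵥ c ·ᵥ z) ≈ x ∙ y - c * (x ∙ z)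
  ∙-sub· x y c z = begin
    x ∙ (y -ᵥ c ·ᵥ z)        ≈⟨ ∙-congˡ (-ᵥ·≋+ᵥ-· y c z) ⟩
    x ∙ (y +ᵥ (- c) ·ᵥ z)    ≈⟨ ∙-add· x y (- c) z ⟩
    x ∙ y + (- c) * (x ∙ z)  ≈⟨ solve 3 (λ y c z → y :+ (:- c) :* z := y :- c :* z) refl _ _ _ ⟩
    x ∙ y - c * (x ∙ z)      ∎

  ∙-sub : (x y z : ℝ^ n) → x ∙ (y -ᵥ z) ≈ x ∙ y - x ∙ z
  ∙-sub x y z = begin
    x ∙ (y -ᵥ z)               ≈⟨ ∙-congˡ (λ i → +-congˡ (-‿cong (sym (*-identityˡ (z i))))) ⟩
    x ∙ (y -ᵥ 1# ·ᵥ z)         ≈⟨ ∙-sub· x y 1# z ⟩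
    x ∙ y - 1# * (x ∙ z)       ≈⟨ +-congˡ (-‿cong (*-identityˡ _)) ⟩
    x ∙ y - x ∙ z              ∎

  ∙-sub·-square : (y : ℝ^ n) (c : Carrier) (z : ℝ^ n) → (y -ᵥ c ·ᵥ z) ∙ (y -ᵥ c ·ᵥ z) ≈
                y ∙ y - 2# * (c * (y ∙ z)) + c * c * (z ∙ z)
  ∙-sub·-square y c z = begin
    w ∙ w                                                  ≈⟨ ∙-sub· w y c z ⟩
    w ∙ y - c * (w ∙ z)                                    ≈⟨ +-cong (trans (∙-comm w y) (∙-sub· y y c z))
                                                               (-‿cong (*-congˡ (trans (∙-comm w z) (∙-sub· z y c z)))) ⟩
    (y ∙ y - c * (y ∙ z)) - c * (z ∙ y - c * (z ∙ z))      ≈⟨ +-congˡ (-‿cong (*-congˡ (+-congʳ (∙-comm z y)))) ⟩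
    (y ∙ y - c * (y ∙ z)) - c * (y ∙ z - c * (z ∙ z))      ≈⟨ solve 4 (λ c a b d → (a :- c :* b) :- c :* (b :- c :* d) := a :- :2 :* (c :* b) :+ c :* c :* d) refl c _ _ _ ⟩
    y ∙ y - 2# * (c * (y ∙ z)) + c * c * (z ∙ z)           ∎
    where w = y -ᵥ c ·ᵥ z

  ∙-sub-square : (y z : ℝ^ n) → (y -ᵥ z) ∙ (y -ᵥ z) ≈ y ∙ y - 2# * (y ∙ z) + z ∙ z
  ∙-sub-square y z = begin
    (y -ᵥ z) ∙ (y -ᵥ z)                              ≈⟨ ∙-cong y-z≋y-1z y-z≋y-1z ⟩
    (y -ᵥ 1# ·ᵥ z) ∙ (y -ᵥ 1# ·ᵥ z)                  ≈⟨ ∙-sub·-square y 1# z ⟩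
    y ∙ y - 2# * (1# * (y ∙ z)) + 1# * 1# * (z ∙ z)
      ≈⟨ solve 3 (λ a b d → a :- :2 :* (:1 :* b) :+ :1 :* :1 :* d := a :- :2 :* b :+ d) refl _ _ _ ⟩
    y ∙ y - 2# * (y ∙ z) + z ∙ z                     ∎
    where
    y-z≋y-1z : y -ᵥ z ≋ y -ᵥ 1# ·ᵥ z
    y-z≋y-1z i = +-congˡ (-‿cong (sym (*-identityˡ (z i))))

  ∙-definite : (x : ℝ^ n) → x ∙ x ≈ 0# → x ≋ 0ᵥ
  ∙-definite x x∙x≈0 Fin.zero =
    square≈0⇒≈0 (+≈0⇒≈0ˡ (square-nonNeg _) (∙-nonNeg (x ∘ Fin.suc)) x∙x≈0)
  ∙-definite x x∙x≈0 (Fin.suc i) =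
    ∙-definite (x ∘ Fin.suc)
      (+≈0⇒≈0ˡ (∙-nonNeg (x ∘ Fin.suc)) (square-nonNeg _) (trans (+-comm _ _) x∙x≈0)) i

  ∙-zeroʳ : (x : ℝ^ n) {y : ℝ^ n} → y ≋ 0ᵥ → x ∙ y ≈ 0#
  ∙-zeroʳ {n} x y≋0 =
    trans (sum-cong-≋ (λ i → trans (*-congˡ (y≋0 i)) (zeroʳ (x i)))) (sum-replicate-zero n)

  -- Serves in the eigenbasis of `M`, where the error estimate splits into one scalar inequality per
  -- coordinate.
  ∙-mono : ∀ {a b} (x y : ℝ^ n) → (∀ i → a * (x i * x i) ≤ b * (y i * y i)) →
           a * (x ∙ x) ≤ b * (y ∙ y)
  ∙-mono {ℕ.zero} {a} {b} x y h = ≤-reflexive (trans (zeroʳ a) (sym (zeroʳ b)))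
  ∙-mono {ℕ.suc n} {a} {b} x y h = 0≤-⇒≤ (≤-respʳ-≈
    (solve 6 (λ a b p q r s → (b :* q :- a :* p) :+ (b :* s :- a :* r) := b :* (q :+ s) :- a :* (p :+ r)) refl a b _ _ _ _)
    (+-nonNeg (≤⇒0≤- (h Fin.zero))
      (≤⇒0≤- (∙-mono (x ∘ Fin.suc) (y ∘ Fin.suc) (h ∘ Fin.suc)))))

  ∙-single : (i : Fin n) (a x : ℝ^ n) → (∀ j → ¬ i ≡ j → a j ≈ 0#) → a ∙ x ≈ a i * x i
  ∙-single {ℕ.suc n} i a x a-off = begin
    a ∙ x                                               ≈⟨ sum-remove {i = i} (zipWith _*_ a x) ⟩
    a i * x i + sum (λ j → a (Fin.punchIn i j) * x (Fin.punchIn i j))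
      ≈⟨ +-congˡ (sum-cong-≋ (λ j → trans (*-congʳ (a-off _ (Fin.punchInᵢ≢i i j ∘ ≡.sym))) (zeroˡ _))) ⟩
    a i * x i + sum {n} (λ _ → 0#)                      ≈⟨ +-congˡ (sum-replicate-zero n) ⟩
    a i * x i + 0#                                      ≈⟨ +-identityʳ _ ⟩
    a i * x i                                           ∎

  *ᵥ-cong : {A B : Matrix m n} {x y : ℝ^ n} → A ≋ₘ B → x ≋ y → A *ᵥ x ≋ B *ᵥ y
  *ᵥ-cong A≋B x≋y i = ∙-cong (A≋B i) x≋y

  *ᵥ-congˡ : (A : Matrix m n) {x y : ℝ^ n} → x ≋ y → A *ᵥ x ≋ A *ᵥ y
  *ᵥ-congˡ A x≋y i = ∙-congˡ x≋y

  *ᵥ-adjoint : (A : Matrix m n) (x : ℝ^ m) (y : ℝ^ n) → x ∙ (A *ᵥ y) ≈ (transpose A *ᵥ x) ∙ y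
  *ᵥ-adjoint A x y = begin
    sum (λ i → x i * sum (λ j → A i j * y j))    ≈⟨ sum-cong-≋ (λ i → *-distribˡ-sum (x i) (zipWith _*_ (A i) y)) ⟩
    sum (λ i → sum (λ j → x i * (A i j * y j)))  ≈⟨ ∑-comm (λ i j → x i * (A i j * y j)) ⟩
    sum (λ j → sum (λ i → x i * (A i j * y j)))  ≈⟨ sum-cong-≋ (λ j → sum-cong-≋ (λ i → solve 3 (λ x a y → x :* (a :* y) := a :* x :* y) refl (x i) (A i j) (y j))) ⟩
    sum (λ j → sum (λ i → A i j * x i * y j))    ≈⟨ sum-cong-≋ (λ j → *-distribʳ-sum (y j) (λ i → A i j * x i)) ⟨
    sum (λ j → sum (λ i → A i j * x i) * y j)    ∎

  -- Associativity is the adjoint identity for the row `A i`: up to commuting factors,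
  -- `transpose B *ᵥ A i` is row `i` of `A *ₘ B`.
  *ₘ-*ᵥ : (A : Matrix k l) (B : Matrix l m) (x : ℝ^ m) → (A *ₘ B) *ᵥ x ≋ A *ᵥ (B *ᵥ x)
  *ₘ-*ᵥ A B x i = sym (trans (*ᵥ-adjoint B (A i) x)
    (∙-cong {y = x} (λ j → ∙-comm (transpose B j) (A i)) (λ _ → refl)))

  transpose-*ₘ-*ᵥ : (A : Matrix k l) (B : Matrix l m) (x : ℝ^ k) →
                    transpose (A *ₘ B) *ᵥ x ≋ transpose B *ᵥ (transpose A *ᵥ x)
  transpose-*ₘ-*ᵥ A B x = ≋-trans
    (*ᵥ-cong {x = x} (λ i j → ∙-comm (A j) (transpose B i)) (λ _ → refl))
    (*ₘ-*ᵥ (transpose B) (transpose A) x)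

  I-*ᵥ : (x : ℝ^ n) → I *ᵥ x ≋ x
  I-*ᵥ x i = trans (∙-single i (I i) x off) (trans (*-congʳ diagonal) (*-identityˡ (x i)))
    where
    off : ∀ j → ¬ i ≡ j → I i j ≈ 0#
    off j i≢j with i Fin.≟ j
    ... | yes i≡j = ⊥-elim (i≢j i≡j)
    ... | no  _   = refl
    diagonal : I i i ≈ 1#
    diagonal with i Fin.≟ i
    ... | yes _   = refl
    ... | no  i≢i = ⊥-elim (i≢i ≡.refl)

  *ₘ≋I⇒inverse : (A : Matrix m n) (B : Matrix n m) → A *ₘ B ≋ₘ I → ∀ x → A *ᵥ (B *ᵥ x) ≋ x
  *ₘ≋I⇒inverse A B AB≋I x =
    ≋-trans (≋-sym (*ₘ-*ᵥ A B x)) (≋-trans (*ᵥ-cong AB≋I (λ _ → refl)) (I-*ᵥ x))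

  orthogonal-isometry : (U : Matrix n n) → IsOrthogonal U → ∀ x y → (U *ᵥ x) ∙ (U *ᵥ y) ≈ x ∙ y
  orthogonal-isometry U (UᵀU≋I , _) x y = begin
    (U *ᵥ x) ∙ (U *ᵥ y)              ≈⟨ *ᵥ-adjoint U (U *ᵥ x) y ⟩
    (transpose U *ᵥ (U *ᵥ x)) ∙ y    ≈⟨ ∙-cong {y = y} (*ₘ≋I⇒inverse (transpose U) U UᵀU≋I x) (λ _ → refl) ⟩
    x ∙ y                            ∎

  diagonal⇒symmetric : {D : Matrix n n} → IsDiagonal D → IsSymmetric D
  diagonal⇒symmetric D-diag i j with i Fin.≟ j
  ... | yes ≡.refl = refl
  ... | no  i≢j    = trans (D-diag j i (i≢j ∘ ≡.sym)) (sym (D-diag i j i≢j))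

  module _ (m≤n : m ℕ.≤ n) (σ : ℝ^ m) where

    rectDiagonal-on : ∀ i → rectDiagonal m≤n σ i (inject≤ i m≤n) ≈ σ i
    rectDiagonal-on i with inject≤ i m≤n Fin.≟ inject≤ i m≤n
    ... | yes _ = refl
    ... | no  ≢ = ⊥-elim (≢ ≡.refl)

    rectDiagonal-off : ∀ i j → ¬ inject≤ i m≤n ≡ j → rectDiagonal m≤n σ i j ≈ 0#
    rectDiagonal-off i j ≢ with inject≤ i m≤n Fin.≟ j
    ... | yes ≡ = ⊥-elim (≢ ≡)
    ... | no  _ = refl

    rectDiagonal-*ᵥ : ∀ x i → (rectDiagonal m≤n σ *ᵥ x) i ≈ σ i * x (inject≤ i m≤n)
    rectDiagonal-*ᵥ x i =
      trans (∙-single (inject≤ i m≤n) (rectDiagonal m≤n σ i) x (rectDiagonal-off i))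
            (*-congʳ (rectDiagonal-on i))

    -- Injectivity of `inject≤` leaves one nonzero entry in the column. Only the first `m`
    -- coordinates are evaluated, which are those that `rectDiagonal-*ᵥ` reads.
    rectDiagonalᵀ-*ᵥ : ∀ y i → (transpose (rectDiagonal m≤n σ) *ᵥ y) (inject≤ i m≤n) ≈ σ i * y i
    rectDiagonalᵀ-*ᵥ y i =
      trans (∙-single i (λ k → rectDiagonal m≤n σ k (inject≤ i m≤n)) y
              (λ k i≢k → rectDiagonal-off k _ (i≢k ∘ ≡.sym ∘ Fin.inject≤-injective m≤n m≤n k i)))
            (*-congʳ (rectDiagonal-on i))

    rectDiagonal-gram : ∀ y → rectDiagonal m≤n σ *ᵥ (transpose (rectDiagonal m≤n σ) *ᵥ y) ≋
                              (λ i → σ i * σ i * y i)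
    rectDiagonal-gram y i = begin
      _                    ≈⟨ rectDiagonal-*ᵥ _ i ⟩
      _                    ≈⟨ *-congˡ (rectDiagonalᵀ-*ᵥ y i) ⟩
      σ i * (σ i * y i)    ≈⟨ *-assoc _ _ _ ⟨
      σ i * σ i * y i      ∎

-- Spectral form of the system matrix.

module Spectrum (ℝ : RealField) where

  open RealField ℝ
  open LinearAlgebra ℝ
  open OrderedField ℝ
  open Vectors ℝ
  open DifferenceSolver commutativeRing
  open VectorEquality setoid using (≋-refl; ≋-trans; ≋-setoid)

  private variable
    m n : ℕ

  -- `D *ₘ D` is shared between the two factors, and `S` and `D` equal their transposes. Working
  -- with the action on vectors lets products be peeled off one factor at a time.
  gram-*ᵥ : (S : Matrix m m) (A : Matrix m n) (D : Matrix n n) → IsSymmetric S → IsSymmetric D →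
            let K = S *ₘ A *ₘ D in
            ∀ v → (S *ₘ A *ₘ (D *ₘ D) *ₘ transpose A *ₘ S) *ᵥ v ≋ K *ᵥ (transpose K *ᵥ v)
  gram-*ᵥ {m} {n} S A D S-sym D-sym v = begin
    (S *ₘ A *ₘ (D *ₘ D) *ₘ transpose A *ₘ S) *ᵥ v          ≈⟨ *ₘ-*ᵥ (S *ₘ A *ₘ (D *ₘ D) *ₘ transpose A) S v ⟩
    (S *ₘ A *ₘ (D *ₘ D) *ₘ transpose A) *ᵥ S *ᵥ v          ≈⟨ *ₘ-*ᵥ (S *ₘ A *ₘ (D *ₘ D)) (transpose A) (S *ᵥ v) ⟩
    (S *ₘ A *ₘ (D *ₘ D)) *ᵥ transpose A *ᵥ S *ᵥ v          ≈⟨ *ₘ-*ᵥ (S *ₘ A) (D *ₘ D) (transpose A *ᵥ S *ᵥ v) ⟩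
    (S *ₘ A) *ᵥ (D *ₘ D) *ᵥ transpose A *ᵥ S *ᵥ v          ≈⟨ *ᵥ-congˡ (S *ₘ A) (*ₘ-*ᵥ D D (transpose A *ᵥ S *ᵥ v)) ⟩
    (S *ₘ A) *ᵥ D *ᵥ D *ᵥ transpose A *ᵥ S *ᵥ v            ≈⟨ *ₘ-*ᵥ (S *ₘ A) D (D *ᵥ transpose A *ᵥ S *ᵥ v) ⟨
    K *ᵥ D *ᵥ transpose A *ᵥ S *ᵥ v                        ≈⟨ *ᵥ-congˡ K Kᵀv ⟨
    K *ᵥ transpose K *ᵥ v                                  ∎
    where
    K = S *ₘ A *ₘ D
    Kᵀv : transpose K *ᵥ v ≋ D *ᵥ transpose A *ᵥ S *ᵥ v
    Kᵀv = ≋-trans (transpose-*ₘ-*ᵥ (S *ₘ A) D v)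
            (*ᵥ-cong D-sym (≋-trans (transpose-*ₘ-*ᵥ S A v)
              (*ᵥ-congˡ (transpose A) (*ᵥ-cong S-sym (≋-refl {x = v})))))
    open SetoidReasoning (≋-setoid m)

  -- In K Kᵀ = U Σ Vᵀ V Σᵀ Uᵀ the factor Vᵀ V cancels and Σ Σᵀ is diagonal with entries σᵢ²: an
  -- eigendecomposition with eigenvectors the columns of `U`.
  svd-gram : (m≤n : m ℕ.≤ n) (K : Matrix m n) (σ : ℝ^ m) (U : Matrix m m) (V : Matrix n n) →
             IsOrthogonal V → K ≋ₘ U *ₘ rectDiagonal m≤n σ *ₘ transpose V →
             ∀ v → K *ᵥ (transpose K *ᵥ v) ≋ U *ᵥ (λ i → σ i * σ i * (transpose U *ᵥ v) i)
  svd-gram {m} {n} m≤n K σ U V (VᵀV≋I , _) K≋W v = begin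
    K *ᵥ transpose K *ᵥ v                                          ≈⟨ *ᵥ-cong K≋W (*ᵥ-cong (λ i j → K≋W j i) (≋-refl {x = v})) ⟩
    W *ᵥ transpose W *ᵥ v                                          ≈⟨ *ₘ-*ᵥ (U *ₘ Σ) (transpose V) (transpose W *ᵥ v) ⟩
    (U *ₘ Σ) *ᵥ transpose V *ᵥ transpose W *ᵥ v                    ≈⟨ *ᵥ-congˡ (U *ₘ Σ) (*ᵥ-congˡ (transpose V) Wᵀv) ⟩
    (U *ₘ Σ) *ᵥ transpose V *ᵥ V *ᵥ transpose Σ *ᵥ transpose U *ᵥ v
      ≈⟨ *ᵥ-congˡ (U *ₘ Σ) (*ₘ≋I⇒inverse (transpose V) V VᵀV≋I (transpose Σ *ᵥ transpose U *ᵥ v)) ⟩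
    (U *ₘ Σ) *ᵥ transpose Σ *ᵥ transpose U *ᵥ v                    ≈⟨ *ₘ-*ᵥ U Σ (transpose Σ *ᵥ transpose U *ᵥ v) ⟩
    U *ᵥ Σ *ᵥ transpose Σ *ᵥ transpose U *ᵥ v                      ≈⟨ *ᵥ-congˡ U (rectDiagonal-gram m≤n σ (transpose U *ᵥ v)) ⟩
    U *ᵥ (λ i → σ i * σ i * (transpose U *ᵥ v) i)                  ∎
    where
    Σ = rectDiagonal m≤n σ
    W = U *ₘ Σ *ₘ transpose V
    Wᵀv : transpose W *ᵥ v ≋ V *ᵥ transpose Σ *ᵥ transpose U *ᵥ v
    Wᵀv = ≋-trans (transpose-*ₘ-*ᵥ (U *ₘ Σ) (transpose V) v) (*ᵥ-congˡ V (transpose-*ₘ-*ᵥ U Σ v))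
    open SetoidReasoning (≋-setoid m)

  -- The condition 2/(2+ζ) ≤ s ≤ 2/(2-ζ) says that |1 - s| ≤ (ζ/2) s.
  relative-error : ∀ {ζ s} → 2# ≤ s * (2# + ζ) → s * (2# - ζ) ≤ 2# →
                   ∀ u → 2# * 2# * ((u - s * u) * (u - s * u)) ≤ ζ * ζ * (s * u * (s * u))
  relative-error {ζ} {s} lower upper u = 0≤-⇒≤ (≤-respʳ-≈
    -- Difference of squares: ζ²s² - 4(1 - s)² factors as (ζs - 2(1 - s)) (ζs + 2(1 - s)), and these
    -- factors are the slacks of `lower` and `upper`.
    (solve 3 (λ z s u →
        (s :* (:2 :+ z) :- :2) :* (:2 :- s :* (:2 :- z)) :* (u :* u) :=
        z :* z :* (s :* u :* (s :* u)) :- :2 :* :2 :* ((u :- s :* u) :* (u :- s :* u)))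
      refl ζ s u)
    (*-nonNeg (*-nonNeg (≤⇒0≤- lower) (≤⇒0≤- upper)) (square-nonNeg u)))

  -- `U` preserves norms, so both sides may be computed in the coordinates `u` of `v` in the
  -- eigenbasis, where `relative-error` applies to each eigenvalue `s i`.
  diagonalised-error : ∀ {ζ} (M U : Matrix m m) (s : ℝ^ m) → IsOrthogonal U →
    (∀ v → M *ᵥ v ≋ U *ᵥ (λ i → s i * (transpose U *ᵥ v) i)) →
    (∀ i → 2# ≤ s i * (2# + ζ)) → (∀ i → s i * (2# - ζ) ≤ 2#) →
    ∀ v → 2# * 2# * ((v -ᵥ M *ᵥ v) ∙ (v -ᵥ M *ᵥ v)) ≤ ζ * ζ * ((M *ᵥ v) ∙ (M *ᵥ v))
  diagonalised-error {ζ = ζ} M U s U-orth@(_ , UUᵀ≋I) M≋UsUᵀ lower upper v =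
    ≤-respˡ-≈ (*-congˡ (sym norm-v-Mv)) (≤-respʳ-≈ (*-congˡ (sym norm-Mv))
      (∙-mono (u -ᵥ su) su (λ i → relative-error (lower i) (upper i) (u i))))
    where
    u = transpose U *ᵥ v
    su = λ i → s i * u i
    v-Mv : v -ᵥ M *ᵥ v ≋ U *ᵥ (u -ᵥ su)
    v-Mv i = trans
      (+-cong (sym (*ₘ≋I⇒inverse U (transpose U) UUᵀ≋I v i)) (-‿cong (M≋UsUᵀ v i)))
      (sym (∙-sub (U i) u su))
    norm-v-Mv : (v -ᵥ M *ᵥ v) ∙ (v -ᵥ M *ᵥ v) ≈ (u -ᵥ su) ∙ (u -ᵥ su)
    norm-v-Mv = trans (∙-cong v-Mv v-Mv) (orthogonal-isometry U U-orth (u -ᵥ su) (u -ᵥ su))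
    norm-Mv : (M *ᵥ v) ∙ (M *ᵥ v) ≈ su ∙ su
    norm-Mv = trans (∙-cong (M≋UsUᵀ v) (M≋UsUᵀ v)) (orthogonal-isometry U U-orth su su)

-- Convergence of the conjugate gradient iteration.

module ConjugateGradient (ℝ : RealField) where

  open RealField ℝ
  open LinearAlgebra ℝ
  open OrderedField ℝ
  open Vectors ℝ
  open DifferenceSolver commutativeRing
  open VectorEquality setoid using (≋-refl)
  open Sum semiring using (sum-cong-≋)
  open SetoidReasoning setoid

  -- `M` is abstracted to self-adjointness and |x - M x| ≤ (ζ/2) |M x|, the latter squared and
  -- cleared of denominators. Positive definiteness is derived from the second property.
  module Convergence {m : ℕ} (M : Matrix m m) (ζ : Carrier) (ζ²≤1 : ζ * ζ ≤ 1#)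
    (M-selfAdjoint : ∀ x y → x ∙ (M *ᵥ y) ≈ (M *ᵥ x) ∙ y)
    (M-near-1 : ∀ x → 2# * 2# * ((x -ᵥ M *ᵥ x) ∙ (x -ᵥ M *ᵥ x)) ≤
                      ζ * ζ * ((M *ᵥ x) ∙ (M *ᵥ x)))
    where

    -- Since ζ² ≤ 1, expanding 4 |x - M x|² ≤ |M x|² gives 4 |x|² + 3 |M x|² ≤ 8 ⟨x, M x⟩; three
    -- copies each of |x|² and |M x|² are then dropped.
    coercive : ∀ x → x ∙ x ≤ 2# * 2# * 2# * (x ∙ (M *ᵥ x))
    coercive x = 0≤-⇒≤ (≤-respʳ-≈ identity
      (+-nonNeg (≤⇒0≤- (M-near-1 x))
        (+-nonNeg (*-nonNeg (≤⇒0≤- ζ²≤1) N≥0)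
          (+-nonNeg (*-nonNeg 0≤3 N≥0) (*-nonNeg 0≤3 (∙-nonNeg x))))))
      where
      N = (M *ᵥ x) ∙ (M *ᵥ x)
      N≥0 = ∙-nonNeg (M *ᵥ x)
      0≤3 : 0# ≤ 2# + 1#
      0≤3 = +-nonNeg (+-nonNeg 0≤1 0≤1) 0≤1
      identity = trans (+-congʳ (+-congˡ (-‿cong (*-congˡ (∙-sub-square x (M *ᵥ x))))))
        (solve 4 (λ X P N q →
            (q :* N :- :2 :* :2 :* (X :- :2 :* P :+ N)) :+
              ((:1 :- q) :* N :+ ((:2 :+ :1) :* N :+ (:2 :+ :1) :* X)) :=
            :2 :* :2 :* :2 :* P :- X)
          refl (x ∙ x) (x ∙ (M *ᵥ x)) N (ζ * ζ))

    positive-definite : ∀ x → x ∙ (M *ᵥ x) ≈ 0# → x ≋ 0ᵥ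
    positive-definite x xMx≈0 = ∙-definite x
      (antisym (≤-respʳ-≈ (trans (*-congˡ xMx≈0) (zeroʳ _)) (coercive x)) (∙-nonNeg x))

    module _ (b : ℝ^ m) where

      open CGState

      -- After a step, d = r + β d₀ with d₀ the previous direction. The last two fields then express
      -- r ⊥ d₀ and the M-conjugacy of d and d₀ without storing d₀, and they are trivial at the
      -- start, where d = r. Orthogonality between consecutive steps suffices for the estimate.
      record Invariant (s : CGState m) : Set where
        field
          residual-exact      : residual s ≋ b -ᵥ M *ᵥ iterate s
          residual-direction  : residual s ∙ direction s ≈ residual s ∙ residual s
          residual-Mdirection : residual s ∙ (M *ᵥ direction s) ≈ direction s ∙ (M *ᵥ direction s)

      ρ : CGState m → Carrier
      ρ s = residual s ∙ residual s

      init-invariant : Invariant (cgInit b)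
      init-invariant = record
        { residual-exact      = λ i → sym (trans (+-congˡ (-‿cong (∙-zeroʳ (M i) ≋-refl)))
                                  (solve 1 (λ x → x :- con (0 , 0) := x) refl (b i)))
        ; residual-direction  = refl
        ; residual-Mdirection = refl
        }

      -- A single step from a nonzero residual.

      module Step (s : CGState m) (inv : Invariant s) (r≉0 : ¬ residual s ≋ 0ᵥ) where
        open CGState s renaming (iterate to z; residual to r; direction to d)
        open Invariant inv

        P = d ∙ (M *ᵥ d)
        R = r ∙ r
        α = R / P
        r′ = r -ᵥ α ·ᵥ (M *ᵥ d)
        R′ = r′ ∙ r′
        β = R′ / R
        d′ = r′ +ᵥ β ·ᵥ d
        z′ = z +ᵥ α ·ᵥ d

        next : CGState m
        next = record { iterate = z′ ; residual = r′ ; direction = d′ }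

        R≉0 : ¬ R ≈ 0#
        R≉0 R≈0 = r≉0 (∙-definite r R≈0)

        -- If `P` vanished, positive definiteness would make `d` zero, and with it `r ∙ d`, which
        -- equals `R`.
        P≉0 : ¬ P ≈ 0#
        P≉0 P≈0 = R≉0 (trans (sym residual-direction) (∙-zeroʳ r (positive-definite d P≈0)))

        αP≈R : α * P ≈ R
        αP≈R = x/y*y≈x R P≉0

        βR≈R′ : β * R ≈ R′
        βR≈R′ = x/y*y≈x R′ R≉0

        r′⊥d : r′ ∙ d ≈ 0#
        r′⊥d = begin
          r′ ∙ d                       ≈⟨ ∙-comm r′ d ⟩
          d ∙ r′                       ≈⟨ ∙-sub· d r α (M *ᵥ d) ⟩
          d ∙ r - α * P                ≈⟨ +-cong (trans (∙-comm d r) residual-direction) (-‿cong αP≈R) ⟩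
          R - R                        ≈⟨ -‿inverseʳ R ⟩
          0#                           ∎

        -- The `α` of the exact line search along `d` also removes the component along `r`, because
        -- `r` and `d` have the same inner product with `M *ᵥ d`.
        r′⊥r : r′ ∙ r ≈ 0#
        r′⊥r = begin
          r′ ∙ r                       ≈⟨ ∙-comm r′ r ⟩
          r ∙ r′                       ≈⟨ ∙-sub· r r α (M *ᵥ d) ⟩
          R - α * (r ∙ (M *ᵥ d))       ≈⟨ +-congˡ (-‿cong (trans (*-congˡ residual-Mdirection) αP≈R)) ⟩
          R - R                        ≈⟨ -‿inverseʳ R ⟩
          0#                           ∎

        R′≈-αr′Md : R′ ≈ - (α * (r′ ∙ (M *ᵥ d)))
        R′≈-αr′Md = trans (∙-sub· r′ r α (M *ᵥ d)) (trans (+-congʳ r′⊥r) (+-identityˡ _))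

        M-linear : ∀ x c y → M *ᵥ (x +ᵥ c ·ᵥ y) ≋ M *ᵥ x +ᵥ c ·ᵥ (M *ᵥ y)
        M-linear x c y i = ∙-add· (M i) x c y

        -- This conjugacy is what the choice of `β` achieves.
        d⊥Md′ : d ∙ (M *ᵥ d′) ≈ 0#
        d⊥Md′ = begin
          d ∙ (M *ᵥ d′)                      ≈⟨ ∙-congˡ {x = d} (M-linear r′ β d) ⟩
          d ∙ (M *ᵥ r′ +ᵥ β ·ᵥ (M *ᵥ d))     ≈⟨ ∙-add· d (M *ᵥ r′) β (M *ᵥ d) ⟩
          d ∙ (M *ᵥ r′) + β * P              ≈⟨ +-congʳ (trans (M-selfAdjoint d r′) (∙-comm (M *ᵥ d) r′)) ⟩
          T + β * P                          ≈⟨ cancel ⟩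
          0#                                 ∎
          where
          T = r′ ∙ (M *ᵥ d)
          -- Multiplying by `R` clears the denominator of `β`: then R T = α P T, while P β R = P R′
          -- = -α P T.
          R[T+βP]≈0 : R * (T + β * P) ≈ 0#
          R[T+βP]≈0 = begin
            R * (T + β * P)                ≈⟨ solve 4 (λ R T β P → R :* (T :+ β :* P) := R :* T :+ P :* (β :* R)) refl R T β P ⟩
            R * T + P * (β * R)            ≈⟨ +-cong (*-congʳ (sym αP≈R)) (*-congˡ (trans βR≈R′ R′≈-αr′Md)) ⟩
            α * P * T + P * - (α * T)      ≈⟨ solve 3 (λ α P T → α :* P :* T :+ P :* (:- (α :* T)) := con (0 , 0)) refl α P T ⟩
            0#                             ∎
          cancel : T + β * P ≈ 0#
          cancel = begin
            T + β * P                      ≈⟨ *-identityˡ _ ⟨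
            1# * (T + β * P)               ≈⟨ *-congʳ (⁻¹-inverseˡ R≉0) ⟨
            R ⁻¹ * R * (T + β * P)         ≈⟨ *-assoc _ _ _ ⟩
            R ⁻¹ * (R * (T + β * P))       ≈⟨ *-congˡ R[T+βP]≈0 ⟩
            R ⁻¹ * 0#                      ≈⟨ zeroʳ _ ⟩
            0#                             ∎

        next-invariant : Invariant next
        next-invariant = record
          { residual-exact = λ i → begin
              r i - α * (M *ᵥ d) i                       ≈⟨ +-congʳ (residual-exact i) ⟩
              b i - (M *ᵥ z) i - α * (M *ᵥ d) i          ≈⟨ solve 3 (λ b x y → b :- x :- y := b :- (x :+ y)) refl _ _ _ ⟩
              b i - ((M *ᵥ z) i + α * (M *ᵥ d) i)        ≈⟨ +-congˡ (-‿cong (M-linear z α d i)) ⟨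
              b i - (M *ᵥ z′) i                          ∎
          ; residual-direction = begin
              r′ ∙ d′                                    ≈⟨ ∙-add· r′ r′ β d ⟩
              R′ + β * (r′ ∙ d)                          ≈⟨ +-congˡ (trans (*-congˡ r′⊥d) (zeroʳ β)) ⟩
              R′ + 0#                                    ≈⟨ +-identityʳ R′ ⟩
              R′                                         ∎
          ; residual-Mdirection = sym (begin
              d′ ∙ (M *ᵥ d′)                             ≈⟨ ∙-comm d′ (M *ᵥ d′) ⟩
              (M *ᵥ d′) ∙ d′                             ≈⟨ ∙-add· (M *ᵥ d′) r′ β d ⟩
              (M *ᵥ d′) ∙ r′ + β * ((M *ᵥ d′) ∙ d)       ≈⟨ +-cong (∙-comm (M *ᵥ d′) r′) (*-congˡ (trans (∙-comm (M *ᵥ d′) d) d⊥Md′)) ⟩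
              r′ ∙ (M *ᵥ d′) + β * 0#                    ≈⟨ trans (+-congˡ (zeroʳ β)) (+-identityʳ _) ⟩
              r′ ∙ (M *ᵥ d′)                             ∎)
          }

        -- ζ²R - R′ is written as a sum of nonnegative terms: a square standing for Cauchy-Schwarz,
        -- `M-near-1` at `d` scaled by α², (1 - ζ²) R′, and a surplus 2 R′. The first two amount to
        -- 4 R′ ≤ ζ² (R + R′).
        R′≤ζ²R : R′ ≤ ζ * ζ * R
        R′≤ζ²R = 0≤-⇒≤ (≤-respʳ-≈ identity
          (+-nonNeg (*-nonNeg 0≤4 (∙-nonNeg (r′ -ᵥ α ·ᵥ e)))
            (+-nonNeg (*-nonNeg (square-nonNeg α) (≤⇒0≤- (M-near-1 d)))
              (+-nonNeg (*-nonNeg (≤⇒0≤- ζ²≤1) (∙-nonNeg r′))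
                (*-nonNeg 0≤2 (∙-nonNeg r′))))))
          where
          0≤2 = +-nonNeg 0≤1 0≤1
          0≤4 = *-nonNeg 0≤2 0≤2
          e = d -ᵥ M *ᵥ d
          E = e ∙ e
          N = (M *ᵥ d) ∙ (M *ᵥ d)
          T = r′ ∙ (M *ᵥ d)

          -- As ⟨r′, α e⟩ = R′, the cross term turns `R′` into `- R′`. Nonnegativity of the square
          -- thus gives |r′| ≤ |α e| directly.
          [r′-αe]² : (r′ -ᵥ α ·ᵥ e) ∙ (r′ -ᵥ α ·ᵥ e) ≈ α * α * E - R′
          [r′-αe]² = begin
            (r′ -ᵥ α ·ᵥ e) ∙ (r′ -ᵥ α ·ᵥ e)              ≈⟨ ∙-sub·-square r′ α e ⟩
            R′ - 2# * (α * (r′ ∙ e)) + α * α * E         ≈⟨ +-congʳ (+-congˡ (-‿cong (*-congˡ αr′e≈R′))) ⟩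
            R′ - 2# * R′ + α * α * E                     ≈⟨ solve 2 (λ x y → x :- :2 :* x :+ y := y :- x) refl R′ (α * α * E) ⟩
            α * α * E - R′                               ∎
            where
            αr′e≈R′ : α * (r′ ∙ e) ≈ R′
            αr′e≈R′ = begin
              α * (r′ ∙ e)                               ≈⟨ *-congˡ (∙-sub r′ d (M *ᵥ d)) ⟩
              α * (r′ ∙ d - T)                           ≈⟨ *-congˡ (trans (+-congʳ r′⊥d) (+-identityˡ _)) ⟩
              α * (- T)                                  ≈⟨ solve 2 (λ α T → α :* (:- T) := :- (α :* T)) refl α T ⟩
              - (α * T)                                  ≈⟨ R′≈-αr′Md ⟨
              R′                                         ∎

          -- Pythagoras for α M d = r - r′ with r′ ⊥ r, obtained by expanding `R′`, whose cross term
          -- is -2 R.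
          α²N≈R+R′ : α * α * N ≈ R + R′
          α²N≈R+R′ = begin
            α * α * N                                    ≈⟨ solve 2 (λ R x → x := R :+ (R :- :2 :* R :+ x)) refl R (α * α * N) ⟩
            R + (R - 2# * R + α * α * N)                 ≈⟨ +-congˡ (+-congʳ (+-congˡ (-‿cong (*-congˡ (trans (*-congˡ residual-Mdirection) αP≈R))))) ⟨
            R + (R - 2# * (α * (r ∙ (M *ᵥ d))) + α * α * N) ≈⟨ +-congˡ (∙-sub·-square r α (M *ᵥ d)) ⟨
            R + R′                                       ∎

          identity : 2# * 2# * ((r′ -ᵥ α ·ᵥ e) ∙ (r′ -ᵥ α ·ᵥ e)) +
                       (α * α * (ζ * ζ * N - 2# * 2# * E) + ((1# - ζ * ζ) * R′ + 2# * R′)) ≈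
                     ζ * ζ * R - R′
          identity = begin
            2# * 2# * ((r′ -ᵥ α ·ᵥ e) ∙ (r′ -ᵥ α ·ᵥ e)) +
              (α * α * (ζ * ζ * N - 2# * 2# * E) + ((1# - ζ * ζ) * R′ + 2# * R′))
              ≈⟨ +-congʳ (*-congˡ [r′-αe]²) ⟩
            2# * 2# * (α * α * E - R′) +
              (α * α * (ζ * ζ * N - 2# * 2# * E) + ((1# - ζ * ζ) * R′ + 2# * R′))
              ≈⟨ solve 5 (λ a q N E R′ →
                   :2 :* :2 :* (a :* E :- R′) :+ (a :* (q :* N :- :2 :* :2 :* E) :+ ((:1 :- q) :* R′ :+ :2 :* R′)) :=
                   q :* (a :* N) :- q :* R′ :- R′) refl (α * α) (ζ * ζ) N E R′ ⟩
            ζ * ζ * (α * α * N) - ζ * ζ * R′ - R′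
              ≈⟨ +-congʳ (+-congʳ (*-congˡ α²N≈R+R′)) ⟩
            ζ * ζ * (R + R′) - ζ * ζ * R′ - R′
              ≈⟨ solve 3 (λ q R R′ → q :* (R :+ R′) :- q :* R′ :- R′ := q :* R :- R′) refl (ζ * ζ) R R′ ⟩
            ζ * ζ * R - R′ ∎

      step : ∀ s → Invariant s → Invariant (cgStep M s) × ρ (cgStep M s) ≤ ζ * ζ * ρ s
      step s inv = if-elim (λ s′ → Invariant s′ × ρ s′ ≤ ζ * ζ * ρ s)
        (Fin.all? (λ i → residual s i ≟ 0#))
        -- The iteration has stopped: the state is unchanged and both sides of the contraction are
        -- zero.
        (λ r≈0 → inv , ≤-reflexive (trans (ρ≈0 r≈0) (sym (trans (*-congˡ (ρ≈0 r≈0)) (zeroʳ _)))))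
        (λ r≉0 → Step.next-invariant s inv r≉0 , Step.R′≤ζ²R s inv r≉0)
        where
        ρ≈0 : residual s ≋ 0ᵥ → ρ s ≈ 0#
        ρ≈0 = ∙-zeroʳ (residual s)

      -- Monotonicity and geometric decay along the iteration.

      state : ℕ → CGState m
      state = cgState M b

      invariant : ∀ t → Invariant (state t)
      invariant ℕ.zero    = init-invariant
      invariant (ℕ.suc t) = proj₁ (step (state t) (invariant t))

      contraction : ∀ t → ρ (state (ℕ.suc t)) ≤ ζ * ζ * ρ (state t)
      contraction t = proj₂ (step (state t) (invariant t))

      ρ-nonNeg : ∀ s → 0# ≤ ρ s
      ρ-nonNeg s = ∙-nonNeg (residual s)

      -- The order `≤′` grows at its upper end, so each constructor matches one further CG step.
      ρ-antitone : ∀ {i j} → i ℕ.≤′ j → ρ (state j) ≤ ρ (state i)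
      ρ-antitone ℕ.≤′-refl = ≤-refl
      ρ-antitone {j = ℕ.suc j} (ℕ.≤′-step i≤j) = ≤-trans (contraction j)
        (≤-trans (≤-respʳ-≈ (*-identityˡ _) (*-monoʳ-≤ (ρ-nonNeg (state j)) ζ²≤1)) (ρ-antitone i≤j))

      ρ-geometric : ∀ t → ρ (state t) ≤ ζ ^ t * ζ ^ t * (b ∙ b)
      ρ-geometric ℕ.zero    = ≤-reflexive (solve 1 (λ x → x := :1 :* :1 :* x) refl (b ∙ b))
      ρ-geometric (ℕ.suc t) = ≤-trans (contraction t)
        (≤-respʳ-≈ (solve 3 (λ z p x → z :* z :* (p :* p :* x) := z :* p :* (z :* p) :* x) refl ζ (ζ ^ t) (b ∙ b))
          (*-monoˡ-≤ (square-nonNeg ζ) (ρ-geometric t)))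

      -- The recursively updated residual is the true one by `residual-exact`, with opposite sign to
      -- the residual of the theorem; squaring removes the sign.
      residual-norm² : ∀ t → let x = M *ᵥ cg M b t -ᵥ b in x ∙ x ≈ ρ (state t)
      residual-norm² t = sum-cong-≋ (λ i → trans
        (solve 2 (λ x b → (x :- b) :* (x :- b) := (b :- x) :* (b :- x)) refl _ _)
        (sym (*-cong (exact i) (exact i))))
        where exact = Invariant.residual-exact (invariant t)

      norm-antitone : ∀ i j → i ℕ.≤ j → ∥ M *ᵥ cg M b j -ᵥ b ∥ ≤ ∥ M *ᵥ cg M b i -ᵥ b ∥
      norm-antitone i j i≤j = √-mono _ _
        (≤-respˡ-≈ (sym (residual-norm² j)) (≤-respʳ-≈ (sym (residual-norm² i))
          (ρ-antitone (ℕ.≤⇒≤′ i≤j))))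

      norm-geometric : 0# ≤ ζ → ∀ t → ∥ M *ᵥ cg M b t -ᵥ b ∥ ≤ ζ ^ t * ∥ b ∥
      norm-geometric 0≤ζ t = √-scale _ _ (^-nonNeg t)
        (≤-respˡ-≈ (sym (residual-norm² t)) (ρ-geometric t))
        where
        ^-nonNeg : ∀ t → 0# ≤ ζ ^ t
        ^-nonNeg ℕ.zero    = 0≤1
        ^-nonNeg (ℕ.suc t) = *-nonNeg 0≤ζ (^-nonNeg t)

mainTheorem2 :
    (ℝ : RealField) →
    let open RealField ℝ
        open LinearAlgebra ℝ
    in
    (m n : ℕ) .{{_ : NonZero m}} (m≤n : m ℕ.≤ n)
    (A : Matrix m n) → HasRank A m →
    (D : Matrix n n) → IsDiagonal D → (∀ i → 0# < D i i) →
    (p : ℝ^ m) →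
    (ζ : Carrier) → 0# ≤ ζ → ζ ≤ 1# →
    (Q : Matrix m m) → IsSymPosDef Q →
    (Q⁻½ : Matrix m m) → IsInverseSqrt Q Q⁻½ →
    (σ : ℝ^ m) → IsSingularValues m≤n (Q⁻½ *ₘ A *ₘ D) σ →
    2# / (2# + ζ) ≤ σ-min σ ^ 2 →
    σ-min σ ^ 2 ≤ σ-max σ ^ 2 →
    σ-max σ ^ 2 ≤ 2# / (2# - ζ) →
    let M = Q⁻½ *ₘ A *ₘ (D *ₘ D) *ₘ transpose A *ₘ Q⁻½
        b = Q⁻½ *ᵥ p
        z̃ = cg M b
        residualNorm = λ (j : ℕ) → ∥ M *ᵥ z̃ j -ᵥ b ∥
    in
      (∀ i j → i ℕ.≤ j → residualNorm j ≤ residualNorm i)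
    × (∀ t → residualNorm t ≤ ζ ^ t * ∥ b ∥)
-- Matching on `ℕ.suc m` lets `σ-min` and `σ-max` reduce to entries of `σ`; dimension zero is
-- excluded by `NonZero`.
mainTheorem2 ℝ (ℕ.suc m) n m≤n A _ D D-diagonal _ p ζ 0≤ζ ζ≤1 Q _ S ((S-sym , _) , _)
  σ (σ≥0 , σ-antitone , U , V , U-orth , V-orth , svd) lower _ upper =
  norm-antitone b , norm-geometric b 0≤ζ
  where
  open RealField ℝ
  open LinearAlgebra ℝ
  open OrderedField ℝ
  open Vectors ℝ
  open Spectrum ℝ
  open DifferenceSolver commutativeRing
  open VectorEquality setoid using (≋-trans)

  M = S *ₘ A *ₘ (D *ₘ D) *ₘ transpose A *ₘ S
  b = S *ᵥ p
  K = S *ₘ A *ₘ D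

  M≋KKᵀ : ∀ v → M *ᵥ v ≋ K *ᵥ (transpose K *ᵥ v)
  M≋KKᵀ = gram-*ᵥ S A D S-sym (diagonal⇒symmetric D-diagonal)

  -- Both sides equal the inner product of Kᵀx and Kᵀy, which is symmetric.
  M-selfAdjoint : ∀ x y → x ∙ (M *ᵥ y) ≈ (M *ᵥ x) ∙ y
  M-selfAdjoint x y = trans (xMy x y) (trans (∙-comm (transpose K *ᵥ x) (transpose K *ᵥ y))
    (trans (sym (xMy y x)) (∙-comm y (M *ᵥ x))))
    where
    xMy : ∀ x y → x ∙ (M *ᵥ y) ≈ (transpose K *ᵥ x) ∙ (transpose K *ᵥ y)
    xMy x y = trans (∙-congˡ {x = x} (M≋KKᵀ y)) (*ᵥ-adjoint K x (transpose K *ᵥ y))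

  square : ∀ x → x ^ 2 ≈ x * x
  square x = *-congˡ (*-identityʳ x)

  1≤2+ζ : 1# ≤ 2# + ζ
  1≤2+ζ = 0≤-⇒≤ (≤-respʳ-≈ (solve 1 (λ z → :1 :+ z := :2 :+ z :- :1) refl ζ) (+-nonNeg 0≤1 0≤ζ))

  1≤2-ζ : 1# ≤ 2# - ζ
  1≤2-ζ = 0≤-⇒≤ (≤-respʳ-≈ (solve 1 (λ z → :1 :- z := :2 :- z :- :1) refl ζ) (≤⇒0≤- ζ≤1))

  -- The ordering of the singular values carries the bound from the last one to all of them;
  -- nonnegativity allows squaring. The upper bound spreads from the first one likewise.
  σ²-lower : ∀ i → 2# ≤ σ i * σ i * (2# + ζ)
  σ²-lower i = /≤⇒≤* 1≤2+ζ (≤-trans lower (≤-respˡ-≈ (sym (square _))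
    (*-mono-≤ (σ≥0 _) (σ≥0 i) σᵢ≥ σᵢ≥)))
    where σᵢ≥ = σ-antitone i (fromℕ m) (Fin.≤fromℕ i)

  σ²-upper : ∀ i → σ i * σ i * (2# - ζ) ≤ 2#
  σ²-upper i = ≤/⇒*≤ 1≤2-ζ (≤-trans (≤-respʳ-≈ (sym (square _))
    (*-mono-≤ (σ≥0 i) (σ≥0 _) σᵢ≤ σᵢ≤)) upper)
    where σᵢ≤ = σ-antitone Fin.zero i ℕ.z≤n

  M-near-1 : ∀ v → 2# * 2# * ((v -ᵥ M *ᵥ v) ∙ (v -ᵥ M *ᵥ v)) ≤ ζ * ζ * ((M *ᵥ v) ∙ (M *ᵥ v))
  M-near-1 = diagonalised-error M U (λ i → σ i * σ i) U-orth
    (λ v → ≋-trans (M≋KKᵀ v) (svd-gram m≤n K σ U V V-orth svd v)) σ²-lower σ²-upper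

  ζ²≤1 : ζ * ζ ≤ 1#
  ζ²≤1 = ≤-trans (*-mono-≤ 0≤ζ 0≤1 ζ≤1 ζ≤1) (≤-reflexive (*-identityˡ 1#))

  open ConjugateGradient ℝ
  open Convergence M ζ ζ²≤1 M-selfAdjoint M-near-1
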